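{- Let $a$ and $b$ be coprime positive integers, and put $N = a\left\lfloor \frac{b}{2}\right\rfloor + b\left\lfloor \frac{a}{2}\right\rfloor$. Let $R(a,b)$ be the set of integers $n$ with $0 \le n \le N$ such that $n = ax+by$ for some nonnegative integers $x,y$, and let $\mathrm{NR}(a,b)$ be the set of nonnegative integers that cannot be written as $ax+by$ with $x,y$ nonnegative integers. Then \[ R(a,b) = \left\{ai+bj : 0 \le i \le \Big\lfloor \frac{b}{2}\Big\rfloor,\ 0 \le j \le \Big\lfloor \frac{a}{2}\Big\rfloor \right\} \cup \left\{ N - |ai-bj| : 1 \le i \le \Big\lfloor \frac{b}{2}\Big\rfloor,\ 1 \le j \le \Big\lfloor \frac{a}{2}\Big\rfloor \right\}, \] and \[ \mathrm{NR}(a,b) = \{0,1,2,\dots,N\} \setminus R(a,b). \]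
   Context: A nonnegative integer is called representable (with respect to $a,b$) if it equals $ax+by$ for some nonnegative integers $x$ and $y$, and nonrepresentable otherwise. $\lfloor \cdot \rfloor$ denotes the floor function. -}

module Defs where

open import Data.Integer.Base as ℤ using (ℤ; +_)
open import Data.Nat.Base as ℕ using (ℕ; ⌊_/2⌋)
open import Data.Product.Base using (_×_; ∃₂)
open import Level using (0ℓ)
open import Relation.Binary.PropositionalEquality using (_≡_)
open import Relation.Nullary.Negation using (¬_)
open import Relation.Unary using (Pred)

-- All sets are subsets of ℤ, so that the subtraction in N - |ai - bj| is
-- the integer one rather than truncated subtraction on ℕ.

N : ℕ → ℕ → ℕ
N a b = a ℕ.* ⌊ b /2⌋ ℕ.+ b ℕ.* ⌊ a /2⌋

Representable : ℕ → ℕ → Pred ℤ 0ℓ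
Representable a b n = ∃₂ λ (x y : ℕ) → n ≡ + a ℤ.* + x ℤ.+ + b ℤ.* + y

[0‥_] : ℕ → Pred ℤ 0ℓ
[0‥ m ] n = (+ 0 ℤ.≤ n) × (n ℤ.≤ + m)

R : ℕ → ℕ → Pred ℤ 0ℓ
R a b n = [0‥ N a b ] n × Representable a b n

NR : ℕ → ℕ → Pred ℤ 0ℓ
NR a b n = (+ 0 ℤ.≤ n) × ¬ Representable a b n

Sums : ℕ → ℕ → Pred ℤ 0ℓ
Sums a b n = ∃₂ λ (i j : ℕ) →
  (i ℕ.≤ ⌊ b /2⌋) × (j ℕ.≤ ⌊ a /2⌋) ×
  n ≡ + a ℤ.* + i ℤ.+ + b ℤ.* + j

Differences : ℕ → ℕ → Pred ℤ 0ℓ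
Differences a b n = ∃₂ λ (i j : ℕ) →
  (1 ℕ.≤ i) × (i ℕ.≤ ⌊ b /2⌋) × (1 ℕ.≤ j) × (j ℕ.≤ ⌊ a /2⌋) ×
  n ≡ + N a b ℤ.- + ℤ.∣ + a ℤ.* + i ℤ.- + b ℤ.* + j ∣

{-# OPTIONS --safe #-}
module Submission where

-- Put p = ⌊b/2⌋ and q = ⌊a/2⌋.  If n = ax + by ≤ N = ap + bq, then x > p and
-- y > q cannot both hold.  When x ≤ p and y ≤ q, n is one of the sums.  When
-- x = p + i with i > 0 and y = q - j, we have n = N - (bj - ai) with ai ≤ bj,
-- and 2ai ≤ 2bq ≤ ab gives i ≤ p, so n is one of the differences; the case
-- y > q is symmetric.  Every n > N is representable by Sylvester's argument:
-- choose 0 ≤ x < b with ax ≡ n (mod b); as N ≥ ab - a - b, the multiple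
-- n - ax of b exceeds -b, so it is nonnegative.

open import Defs
open import Data.Integer.Base as ℤ using (+_; -[1+_]; _⊖_; ∣_∣)
import Data.Integer.Properties as ℤ
open import Data.Nat.Base using (ℕ; zero; suc; _+_; _*_; _∸_; _≤_; _<_; z≤n; s≤s; ⌊_/2⌋; NonZero; >-nonZero)
open import Data.Nat.Coprimality using (Coprime; coprime-Bézout)
open import Data.Nat.DivMod using (_/_; _%_; m≡m%n+[m/n]*n; m%n<n)
open import Data.Nat.GCD using (module Bézout)
open import Data.Nat.Properties
open import Data.Nat.Tactic.RingSolver using (solve-∀)
open import Data.Product.Base using (_×_; _,_; ∃; ∃₂; proj₁; proj₂)
open import Data.Sum.Base using (_⊎_; inj₁; inj₂)
open import Relation.Binary.PropositionalEquality using (_≡_; refl; sym; trans; cong; cong₂; subst; module ≡-Reasoning)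
open import Relation.Nullary.Negation using (contradiction)
open import Relation.Unary using (_≐_; _∪_; _∖_)

private
  variable
    a b m n x y : ℕ

-- Floors of halves and the size of `N`

2*⌊n/2⌋≤n : ∀ n → 2 * ⌊ n /2⌋ ≤ n
2*⌊n/2⌋≤n zero          = z≤n
2*⌊n/2⌋≤n (suc zero)    = z≤n
2*⌊n/2⌋≤n (suc (suc n)) =
  subst (_≤ suc (suc n)) (sym (*-suc 2 ⌊ n /2⌋)) (s≤s (s≤s (2*⌊n/2⌋≤n n)))

n≤1+2*⌊n/2⌋ : ∀ n → n ≤ 1 + 2 * ⌊ n /2⌋
n≤1+2*⌊n/2⌋ zero          = z≤n
n≤1+2*⌊n/2⌋ (suc zero)    = s≤s z≤n
n≤1+2*⌊n/2⌋ (suc (suc n)) =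
  subst (λ h → suc (suc n) ≤ suc h) (sym (*-suc 2 ⌊ n /2⌋)) (s≤s (s≤s (n≤1+2*⌊n/2⌋ n)))

2*m≤n⇒m≤⌊n/2⌋ : 2 * m ≤ n → m ≤ ⌊ n /2⌋
2*m≤n⇒m≤⌊n/2⌋ {m} {n} 2m≤n = begin
  m              ≡⟨ n≡⌊n+n/2⌋ m ⟩
  ⌊ m + m /2⌋    ≡⟨ cong (λ h → ⌊ m + h /2⌋) (+-identityʳ m) ⟨
  ⌊ 2 * m /2⌋    ≤⟨ ⌊n/2⌋-mono 2m≤n ⟩
  ⌊ n /2⌋        ∎
  where open ≤-Reasoning

N-comm : ∀ a b → N a b ≡ N b a
N-comm a b = +-comm (a * ⌊ b /2⌋) (b * ⌊ a /2⌋)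

-- As `2 * ⌊ b /2⌋` is at least b - 1, and likewise for a, 2N is at least 2ab - a - b. This places
-- `N` above the Frobenius number ab - a - b.
ab≤N+a+b : ∀ a b → a * b ≤ N a b + (a + b)
ab≤N+a+b a b = *-cancelˡ-≤ 2 (begin
  2 * (a * b)                                     ≡⟨ split a b ⟩
  a * b + b * a                                   ≤⟨ +-mono-≤ (*-monoʳ-≤ a (n≤1+2*⌊n/2⌋ b)) (*-monoʳ-≤ b (n≤1+2*⌊n/2⌋ a)) ⟩
  a * (1 + 2 * ⌊ b /2⌋) + b * (1 + 2 * ⌊ a /2⌋)   ≡⟨ collect a b ⌊ b /2⌋ ⌊ a /2⌋ ⟩
  2 * N a b + (a + b)                             ≤⟨ +-monoʳ-≤ (2 * N a b) (m≤n*m (a + b) 2) ⟩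
  2 * N a b + 2 * (a + b)                         ≡⟨ *-distribˡ-+ 2 (N a b) (a + b) ⟨
  2 * (N a b + (a + b))                           ∎)
  where
  open ≤-Reasoning
  split : ∀ a b → 2 * (a * b) ≡ a * b + b * a
  split = solve-∀
  collect : ∀ a b p q → a * (1 + 2 * p) + b * (1 + 2 * q) ≡ 2 * (a * p + b * q) + (a + b)
  collect = solve-∀

-- Sylvester's bound

Repr : ℕ → ℕ → ℕ → Set
Repr a b n = ∃₂ λ x y → n ≡ a * x + b * y

-- The congruence ax ≡ n (mod b), kept in ℕ by putting a multiple of b on each side: n - ax = b(r -
-- s), so comparing r with s gives the sign of n - ax. A Bézout coefficient times n solves it, and
-- the solution is then reduced modulo b.
solve-mod : Coprime a b → 0 < b → ∀ n →
            ∃₂ λ x s → ∃ λ r → x < b × n + b * s ≡ a * x + b * r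
solve-mod {a} {b@(suc b-1)} a⊥b _ n = reduce (unreduced (coprime-Bézout a⊥b))
  where
  open ≡-Reasoning

  unreduced : Bézout.Identity 1 a b → ∃₂ λ t s → ∃ λ r → n + b * s ≡ a * t + b * r
  unreduced (Bézout.+- u v 1+vb≡ua) = u * n , v * n , 0 , (begin
    n + b * (v * n)        ≡⟨ lhs n b v ⟩
    (1 + v * b) * n        ≡⟨ cong (_* n) 1+vb≡ua ⟩
    u * a * n              ≡⟨ rhs a b u n ⟩
    a * (u * n) + b * 0    ∎)
    where
    lhs : ∀ n b v → n + b * (v * n) ≡ (1 + v * b) * n
    lhs = solve-∀
    rhs : ∀ a b u n → u * a * n ≡ a * (u * n) + b * 0
    rhs = solve-∀
  -- Here ua ≡ -1 (mod b), so the inverse of a is -u; the factor `b-1` stands for -1 and keeps the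
  -- witness a natural number.
  unreduced (Bézout.-+ u v 1+ua≡vb) = u * n * b-1 , a * (u * n) , v * n , (begin
    n + b * (a * (u * n))                    ≡⟨ lhs n b-1 a u ⟩
    a * (u * n * b-1) + (1 + u * a) * n      ≡⟨ cong (λ h → a * (u * n * b-1) + h * n) 1+ua≡vb ⟩
    a * (u * n * b-1) + v * b * n            ≡⟨ cong (λ h → a * (u * n * b-1) + h) (rhs v b n) ⟩
    a * (u * n * b-1) + b * (v * n)          ∎)
    where
    lhs : ∀ n c a u → n + (1 + c) * (a * (u * n)) ≡ a * (u * n * c) + (1 + u * a) * n
    lhs = solve-∀
    rhs : ∀ v b n → v * b * n ≡ b * (v * n)
    rhs = solve-∀

  reduce : (∃₂ λ t s → ∃ λ r → n + b * s ≡ a * t + b * r) →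
           ∃₂ λ x s → ∃ λ r → x < b × n + b * s ≡ a * x + b * r
  reduce (t , s , r , eq) = t % b , s , a * (t / b) + r , m%n<n t b , (begin
    n + b * s                               ≡⟨ eq ⟩
    a * t + b * r                           ≡⟨ cong (λ h → a * h + b * r) (m≡m%n+[m/n]*n t b) ⟩
    a * (t % b + t / b * b) + b * r         ≡⟨ regroup a b (t % b) (t / b) r ⟩
    a * (t % b) + b * (a * (t / b) + r)     ∎)
    where
    regroup : ∀ a b x k r → a * (x + k * b) + b * r ≡ a * x + b * (a * k + r)
    regroup = solve-∀

-- The hypothesis is n > ab - a - b with the subtractions cleared.
sylvester : Coprime a b → 0 < b → a * b < n + (a + b) → Repr a b n
sylvester {a} {b} {n} a⊥b 0<b large with solve-mod a⊥b 0<b n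
... | x , s , r , x<b , eq with ≤-<-connex s r
...   | inj₁ s≤r = x , r ∸ s , +-cancelʳ-≡ (b * s) n _ (begin
  n + b * s                      ≡⟨ eq ⟩
  a * x + b * r                  ≡⟨ cong (λ h → a * x + b * h) (m∸n+n≡m s≤r) ⟨
  a * x + b * (r ∸ s + s)        ≡⟨ regroup (a * x) b (r ∸ s) s ⟩
  a * x + b * (r ∸ s) + b * s    ∎)
  where
  open ≡-Reasoning
  regroup : ∀ m b d s → m + b * (d + s) ≡ m + b * d + b * s
  regroup = solve-∀
-- Now n - ax is a negative multiple of b, so n + b ≤ ax ≤ a(b - 1), against the size of n.
...   | inj₂ r<s = contradiction large (≤⇒≯ (begin
  n + (a + b)    ≡⟨ swap n a b ⟩
  a + (n + b)    ≤⟨ +-monoʳ-≤ a n+b≤ax ⟩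
  a + a * x      ≡⟨ *-suc a x ⟨
  a * suc x      ≤⟨ *-monoʳ-≤ a x<b ⟩
  a * b          ∎))
  where
  open ≤-Reasoning
  swap : ∀ n a b → n + (a + b) ≡ a + (n + b)
  swap = solve-∀
  regroup : ∀ n b r → n + b + b * r ≡ n + b * suc r
  regroup = solve-∀
  n+b≤ax : n + b ≤ a * x
  n+b≤ax = +-cancelʳ-≤ (b * r) (n + b) (a * x) (begin
    n + b + b * r    ≡⟨ regroup n b r ⟩
    n + b * suc r    ≤⟨ +-monoʳ-≤ n (*-monoʳ-≤ b r<s) ⟩
    n + b * s        ≡⟨ eq ⟩
    a * x + b * r    ∎)

N<n⇒repr : Coprime a b → 0 < b → N a b < n → Repr a b n
N<n⇒repr {a} {b} a⊥b 0<b N<n =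
  sylvester a⊥b 0<b (≤-<-trans (ab≤N+a+b a b) (+-monoˡ-< (a + b) N<n))

-- Representable numbers up to N

-- The differences N - |ai - bj| with ai ≤ bj, as an equation without subtraction.
LowerDiff : ℕ → ℕ → ℕ → Set
LowerDiff a b n = ∃₂ λ i j →
  1 ≤ i × i ≤ ⌊ b /2⌋ × 1 ≤ j × j ≤ ⌊ a /2⌋ ×
  a * i ≤ b * j × n + b * j ≡ N a b + a * i

lowerDiff⇒≤N : LowerDiff a b n → n ≤ N a b
lowerDiff⇒≤N {a} {b} {n} (i , j , _ , _ , _ , _ , ai≤bj , eq) =
  +-cancelʳ-≤ (b * j) n (N a b)
    (≤-trans (≤-reflexive eq) (+-monoʳ-≤ (N a b) ai≤bj))

-- With p = ⌊b/2⌋ and q = ⌊a/2⌋, N - bj + ai = a(p + i) + b(q - j), and q - j is nonnegative.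
lowerDiff⇒repr : LowerDiff a b n → Repr a b n
lowerDiff⇒repr {a} {b} {n} (i , j , _ , _ , _ , j≤q , _ , eq) =
  ⌊ b /2⌋ + i , ⌊ a /2⌋ ∸ j , +-cancelʳ-≡ (b * j) n _ (begin
    n + b * j                                               ≡⟨ eq ⟩
    a * ⌊ b /2⌋ + b * ⌊ a /2⌋ + a * i                       ≡⟨ cong (λ h → a * ⌊ b /2⌋ + b * h + a * i) (m∸n+n≡m j≤q) ⟨
    a * ⌊ b /2⌋ + b * (⌊ a /2⌋ ∸ j + j) + a * i             ≡⟨ regroup a b ⌊ b /2⌋ i (⌊ a /2⌋ ∸ j) j ⟩
    a * (⌊ b /2⌋ + i) + b * (⌊ a /2⌋ ∸ j) + b * j           ∎)
  where
  open ≡-Reasoning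
  regroup : ∀ a b p i d j → a * p + b * (d + j) + a * i ≡ a * (p + i) + b * d + b * j
  regroup = solve-∀

x>⌊b/2⌋⇒lowerDiff : 0 < a → n ≡ a * x + b * y → n ≤ N a b →
                    ⌊ b /2⌋ < x → y ≤ ⌊ a /2⌋ → LowerDiff a b n
x>⌊b/2⌋⇒lowerDiff {a} {n} {x} {b} {y} 0<a n≡ n≤N p<x y≤q =
  i , j , 0<i , 2*m≤n⇒m≤⌊n/2⌋ 2i≤b , 0<j , m∸n≤m q y , ai≤bj , eq
  where
  p = ⌊ b /2⌋
  q = ⌊ a /2⌋
  i = x ∸ p
  j = q ∸ y

  instance
    a≢0 : NonZero a
    a≢0 = >-nonZero 0<a

  0<i : 0 < i
  0<i = m<n⇒0<n∸m p<x

  eq : n + b * j ≡ N a b + a * i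
  eq = begin
    n + b * j                              ≡⟨ cong (_+ b * j) n≡ ⟩
    a * x + b * y + b * j                  ≡⟨ cong (λ h → a * h + b * y + b * j) (m+[n∸m]≡n (<⇒≤ p<x)) ⟨
    a * (p + i) + b * y + b * j            ≡⟨ regroup a b p i y j ⟩
    a * p + b * (y + j) + a * i            ≡⟨ cong (λ h → a * p + b * h + a * i) (m+[n∸m]≡n y≤q) ⟩
    N a b + a * i                          ∎
    where
    open ≡-Reasoning
    regroup : ∀ a b p i y j → a * (p + i) + b * y + b * j ≡ a * p + b * (y + j) + a * i
    regroup = solve-∀

  open ≤-Reasoning

  -- This is n ≤ N read through `eq`.
  ai≤bj : a * i ≤ b * j
  ai≤bj = +-cancelˡ-≤ (N a b) (a * i) (b * j) (begin
    N a b + a * i    ≡⟨ eq ⟨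
    n + b * j        ≤⟨ +-monoˡ-≤ (b * j) n≤N ⟩
    N a b + b * j    ∎)

  0<j : 0 < j
  0<j = *-cancelˡ-< b 0 j (begin-strict
    b * 0    ≡⟨ *-zeroʳ b ⟩
    -- The strict inequality unfolds to `1 * 1 ≤ a * i`.
    0        <⟨ *-mono-≤ 0<a 0<i ⟩
    a * i    ≤⟨ ai≤bj ⟩
    b * j    ∎)

  2i≤b : 2 * i ≤ b
  2i≤b = *-cancelˡ-≤ a (begin
    a * (2 * i)    ≡⟨ swap a i ⟩
    2 * (a * i)    ≤⟨ *-monoʳ-≤ 2 ai≤bj ⟩
    2 * (b * j)    ≤⟨ *-monoʳ-≤ 2 (*-monoʳ-≤ b (m∸n≤m q y)) ⟩
    2 * (b * q)    ≡⟨ swap b q ⟨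
    b * (2 * q)    ≤⟨ *-monoʳ-≤ b (2*⌊n/2⌋≤n a) ⟩
    b * a          ≡⟨ *-comm b a ⟩
    a * b          ∎)
    where
    swap : ∀ m n → m * (2 * n) ≡ 2 * (m * n)
    swap = solve-∀

Sum : ℕ → ℕ → ℕ → Set
Sum a b n = ∃₂ λ i j → i ≤ ⌊ b /2⌋ × j ≤ ⌊ a /2⌋ × n ≡ a * i + b * j

sum⇒≤N : Sum a b n → n ≤ N a b
sum⇒≤N {a} {b} (i , j , i≤p , j≤q , refl) = +-mono-≤ (*-monoʳ-≤ a i≤p) (*-monoʳ-≤ b j≤q)

-- The last alternative is the case y > ⌊a/2⌋: exchanging a with b and x with y reduces it to the
-- case x > ⌊b/2⌋.
repr⇒sum⊎lowerDiff : 0 < a → 0 < b → Repr a b n → n ≤ N a b →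
                     Sum a b n ⊎ LowerDiff a b n ⊎ LowerDiff b a n
repr⇒sum⊎lowerDiff {a} {b} {n} 0<a 0<b (x , y , n≡) n≤N
  with ≤-<-connex x ⌊ b /2⌋ | ≤-<-connex y ⌊ a /2⌋
... | inj₁ x≤p | inj₁ y≤q = inj₁ (x , y , x≤p , y≤q , n≡)
... | inj₂ p<x | inj₁ y≤q = inj₂ (inj₁ (x>⌊b/2⌋⇒lowerDiff 0<a n≡ n≤N p<x y≤q))
... | inj₁ x≤p | inj₂ q<y = inj₂ (inj₂ (x>⌊b/2⌋⇒lowerDiff 0<b
  (trans n≡ (+-comm (a * x) (b * y))) (subst (n ≤_) (N-comm a b) n≤N) q<y x≤p))
-- Since a > 0, the term ax alone already makes ax + by exceed ap + bq strictly.
... | inj₂ p<x | inj₂ q<y = contradiction n≤N (<⇒≱ (subst (N a b <_) (sym n≡)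
  (+-mono-<-≤ (*-monoʳ-< a {{>-nonZero 0<a}} p<x) (*-monoʳ-≤ b (<⇒≤ q<y)))))

-- Translation to ℤ

pos-comb : ∀ a b x y → + (a * x + b * y) ≡ + a ℤ.* + x ℤ.+ + b ℤ.* + y
pos-comb a b x y = cong₂ ℤ._+_ (ℤ.pos-* a x) (ℤ.pos-* b y)

repr⇒representable : Repr a b n → Representable a b (+ n)
repr⇒representable {a} {b} (x , y , eq) = x , y , trans (cong +_ eq) (pos-comb a b x y)

representable⇒repr : Representable a b (+ n) → Repr a b n
representable⇒repr {a} {b} (x , y , eq) =
  x , y , ℤ.+-injective (trans eq (sym (pos-comb a b x y)))

-- For m ≤ n the absolute value is `n ∸ m`, and the equation says M = k + (n - m). This turns the
-- subtraction-free equation of `LowerDiff` into the integer formula of `Differences`.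
minus-abs-diff : m ≤ n → ∀ k M → k + n ≡ M + m → + k ≡ + M ℤ.- + ∣ + m ℤ.- + n ∣
minus-abs-diff {m} {n} m≤n k M eq = sym (begin
  + M ℤ.- + ∣ + m ℤ.- + n ∣       ≡⟨ cong (λ h → + M ℤ.- + ∣ h ∣) (ℤ.m-n≡m⊖n m n) ⟩
  + M ℤ.- + ∣ m ⊖ n ∣             ≡⟨ cong (λ h → + M ℤ.- + h) (ℤ.∣⊖∣-≤ m≤n) ⟩
  + M ℤ.- + (n ∸ m)               ≡⟨ cong (λ h → + h ℤ.- + (n ∸ m)) M≡ ⟩
  + (k + (n ∸ m)) ℤ.- + (n ∸ m)   ≡⟨ ℤ.m-n≡m⊖n (k + (n ∸ m)) (n ∸ m) ⟩
  (k + (n ∸ m)) ⊖ (n ∸ m)         ≡⟨ ℤ.⊖-≥ (m≤n+m (n ∸ m) k) ⟩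
  + (k + (n ∸ m) ∸ (n ∸ m))       ≡⟨ cong +_ (m+n∸n≡m k (n ∸ m)) ⟩
  + k                             ∎)
  where
  open ≡-Reasoning
  M≡ : M ≡ k + (n ∸ m)
  M≡ = +-cancelʳ-≡ m M _ (begin
    M + m               ≡⟨ eq ⟨
    k + n               ≡⟨ cong (λ h → k + h) (m∸n+n≡m m≤n) ⟨
    k + (n ∸ m + m)     ≡⟨ +-assoc k (n ∸ m) m ⟨
    k + (n ∸ m) + m     ∎)

minus-abs-diff-products : ∀ a b i j k M → a * i ≤ b * j → k + b * j ≡ M + a * i →
                          + k ≡ + M ℤ.- + ∣ + a ℤ.* + i ℤ.- + b ℤ.* + j ∣
minus-abs-diff-products a b i j k M ai≤bj eq
  rewrite sym (ℤ.pos-* a i) | sym (ℤ.pos-* b j) = minus-abs-diff ai≤bj k M eq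

difference-comm : ∀ a b i j → + N a b ℤ.- + ∣ + a ℤ.* + i ℤ.- + b ℤ.* + j ∣ ≡
                               + N b a ℤ.- + ∣ + b ℤ.* + j ℤ.- + a ℤ.* + i ∣
difference-comm a b i j =
  cong₂ (λ M d → + M ℤ.- + d) (N-comm a b) (ℤ.∣i-j∣≡∣j-i∣ (+ a ℤ.* + i) (+ b ℤ.* + j))

differences-comm : ∀ {z} → Differences a b z → Differences b a z
differences-comm {a} {b} (i , j , 1≤i , i≤p , 1≤j , j≤q , z≡) =
  j , i , 1≤j , j≤q , 1≤i , i≤p , trans z≡ (difference-comm a b i j)

lowerDiff⇒differences : LowerDiff a b n → Differences a b (+ n)
lowerDiff⇒differences {a} {b} {n} (i , j , 1≤i , i≤p , 1≤j , j≤q , ai≤bj , eq) =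
  i , j , 1≤i , i≤p , 1≤j , j≤q , minus-abs-diff-products a b i j n (N a b) ai≤bj eq

lowerDiff⇒R : LowerDiff a b n → R a b (+ n)
lowerDiff⇒R {a} {b} d = (ℤ.+≤+ z≤n , ℤ.+≤+ (lowerDiff⇒≤N d)) , repr⇒representable {a} {b} (lowerDiff⇒repr d)

R-comm : ∀ {z} → R a b z → R b a z
R-comm {a} {b} {z} ((0≤z , z≤N) , x , y , eq) =
  (0≤z , subst (λ M → z ℤ.≤ + M) (N-comm a b) z≤N) ,
  y , x , trans eq (ℤ.+-comm (+ a ℤ.* + x) (+ b ℤ.* + y))

lower-differences⊆R : ∀ {i j z} → 1 ≤ i → i ≤ ⌊ b /2⌋ → 1 ≤ j → j ≤ ⌊ a /2⌋ → a * i ≤ b * j →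
                      z ≡ + N a b ℤ.- + ∣ + a ℤ.* + i ℤ.- + b ℤ.* + j ∣ → R a b z
lower-differences⊆R {b} {a} {i} {j} 1≤i i≤p 1≤j j≤q ai≤bj z≡ =
  subst (R a b) (trans (minus-abs-diff-products a b i j k (N a b) ai≤bj eq) (sym z≡))
    (lowerDiff⇒R (i , j , 1≤i , i≤p , 1≤j , j≤q , ai≤bj , eq))
  where
  -- The natural number that z equals; the truncated subtraction is exact because bj ≤ b⌊a/2⌋ ≤ N.
  k = N a b + a * i ∸ b * j
  eq : k + b * j ≡ N a b + a * i
  eq = m∸n+n≡m (≤-trans (*-monoʳ-≤ b j≤q)
         (≤-trans (m≤n+m (b * ⌊ a /2⌋) (a * ⌊ b /2⌋)) (m≤m+n (N a b) (a * i))))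

-- Exchanging a with b and i with j preserves both the difference and `R`, so ai ≤ bj may be
-- assumed.
differences⊆R : ∀ {z} → Differences a b z → R a b z
differences⊆R {a} {b} (i , j , 1≤i , i≤p , 1≤j , j≤q , z≡) with ≤-total (a * i) (b * j)
... | inj₁ ai≤bj = lower-differences⊆R 1≤i i≤p 1≤j j≤q ai≤bj z≡
... | inj₂ bj≤ai = R-comm {b} {a}
  (lower-differences⊆R 1≤j j≤q 1≤i i≤p bj≤ai (trans z≡ (difference-comm a b i j)))

sums⊆R : ∀ {z} → Sums a b z → R a b z
sums⊆R {a} {b} (i , j , i≤p , j≤q , z≡) =
  subst (R a b) (trans (pos-comb a b i j) (sym z≡))
    ( (ℤ.+≤+ z≤n , ℤ.+≤+ (sum⇒≤N (i , j , i≤p , j≤q , refl)))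
    , i , j , pos-comb a b i j)

R⊆sums∪differences : 0 < a → 0 < b → ∀ {z} → R a b z → (Sums a b ∪ Differences a b) z
R⊆sums∪differences {a} {b} 0<a 0<b {+ n} ((_ , n≤N) , rep)
  with repr⇒sum⊎lowerDiff 0<a 0<b (representable⇒repr {a} {b} rep) (ℤ.drop‿+≤+ n≤N)
... | inj₁ (i , j , i≤p , j≤q , n≡) =
  inj₁ (i , j , i≤p , j≤q , trans (cong +_ n≡) (pos-comb a b i j))
... | inj₂ (inj₁ d) = inj₂ (lowerDiff⇒differences d)
... | inj₂ (inj₂ d) = inj₂ (differences-comm {b} {a} (lowerDiff⇒differences d))
R⊆sums∪differences _ _ { -[1+ _ ]} ((() , _) , _)

NR⊆[0‥N] : 0 < b → Coprime a b → ∀ {z} → NR a b z → [0‥ N a b ] z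
NR⊆[0‥N] {b} {a} 0<b a⊥b {+ n} (0≤n , ¬rep) =
  0≤n , ℤ.+≤+ (≮⇒≥ λ N<n → ¬rep (repr⇒representable {a} {b} (N<n⇒repr a⊥b 0<b N<n)))
NR⊆[0‥N] _ _ { -[1+ _ ]} (() , _)

theorem4 : (a b : ℕ) → 0 < a → 0 < b → Coprime a b →
    (R a b ≐ Sums a b ∪ Differences a b) × (NR a b ≐ [0‥ N a b ] ∖ R a b)
theorem4 a b 0<a 0<b a⊥b =
  (R⊆sums∪differences 0<a 0<b , λ where
    (inj₁ s) → sums⊆R {a} {b} s
    (inj₂ d) → differences⊆R {a} {b} d) ,
  -- Sylvester's bound confines nonrepresentable numbers to [0, N]; inside that range, lying outside
  -- `R` is the same as being nonrepresentable.
  (λ nr → NR⊆[0‥N] 0<b a⊥b nr , λ r → proj₂ nr (proj₂ r)) ,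
  (λ (z∈ , z∉R) → proj₁ z∈ , λ rep → z∉R (z∈ , rep))
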